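{- There exists a Hoare-McCarthy algebra $\mathbb{A}^{sc}$ (over the atom set $A$) such that for all closed terms $t,t'\in\mathcal{T}_{\Sigma^A_{ce}}$, $$\mathrm{CP}\vdash t=t'\iff \mathbb{A}^{sc}\models t=t'.$$
   Context: Let $A$ be a non-empty, denumerable (finite or countably infinite) set of atoms. $\Sigma^A_{ce}$ is the one-sorted signature with sort $C$ (conditional expressions), constants $T$, $F$ and $a$ (one for each $a\in A$), and a ternary operation $x\triangleleft y\triangleright z$ ("if $y$ then $x$ else $z$"). $\mathcal{T}_{\Sigma^A_{ce}}$ is the set of closed (variable-free) terms over $\Sigma^A_{ce}$. $\mathrm{CP}$ is the set of the four equations (CP1) $x\triangleleft T\triangleright y=x$; (CP2) $x\triangleleft F\triangleright y=y$; (CP3) $T\triangleleft x\triangleright F=x$; (CP4) $x\triangleleft(y\triangleleft z\triangleright u)\triangleright v=(x\triangleleft y\triangleright v)\triangleleft z\triangleright(x\triangleleft u\triangleright v)$. $E\vdash t=t'$ means derivability in equational logic from the set $E$ of equations. A stateful proposition algebra (SPA) is a two-sorted algebra with sorts $C$ and $S$ (states), with the operations of $\Sigma^A_{ce}$ on sort $C$, a constant $c$ of sort $S$, and operations $\cdot\triangleleft\cdot\triangleright\cdot:S\times C\times S\to S$, $\bullet:C\times S\to S$ (apply), $!:C\times S\to C$ (reply), satisfying CP on sort $C$ and, for all $x,y,z$ in $C$ and $s,s'$ in $S$ ($\bullet$ and $!$ bind stronger than the conditional): (TS1) $s\triangleleft T\triangleright s'=s$; (TS2) $s\triangleleft F\triangleright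 s'=s'$; (TS3) if $x\neq T$ and $x\neq F$ then $s\triangleleft x\triangleright s'=c$; (SPA1) $T!s=T$; (SPA2) $F!s=F$; (SPA3) $(x\triangleleft y\triangleright z)!s=x!(y\bullet s)\triangleleft y!s\triangleright z!(y\bullet s)$; (SPA4) $T\bullet s=s$; (SPA5) $F\bullet s=s$; (SPA6) $(x\triangleleft y\triangleright z)\bullet s=x\bullet(y\bullet s)\triangleleft y!s\triangleright z\bullet(y\bullet s)$; (SPA7) $x!s=T$ or $x!s=F$; (SPA8) if $x!s=y!s$ and $x\bullet s=y\bullet s$ for all $s$ in $S$, then $x=y$. A Hoare-McCarthy algebra (HMA) is the $\Sigma^A_{ce}$-reduct of a stateful proposition algebra (i.e. sort $C$ with the operations of $\Sigma^A_{ce}$). -}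

module Defs where

open import Data.Empty using (⊥; ⊥-elim)
open import Data.Fin.Base using (Fin)
open import Data.Nat.Base using (ℕ)
open import Data.Product.Base using (Σ-syntax; ∃-syntax; _×_)
open import Data.Sum.Base using (_⊎_)
open import Function.Bundles using (_⤖_)
open import Level using (0ℓ)
open import Relation.Binary.Core using (Rel)
open import Relation.Binary.PropositionalEquality.Core using (_≡_; _≢_)

Denumerable : Set → Set
Denumerable A = (∃[ n ] (A ⤖ Fin n)) ⊎ (A ⤖ ℕ)

infix 8 _◁_▷_

-- x ◁ y ▷ z  is "if y then x else z".
data Term (A X : Set) : Set where
  var   : X → Term A X
  T F   : Term A X
  atom  : A → Term A X
  _◁_▷_ : (x y z : Term A X) → Term A X

ClosedTerm : Set → Set
ClosedTerm A = Term A ⊥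

_[_] : ∀ {A X Y} → Term A X → (X → Term A Y) → Term A Y
var x       [ σ ] = σ x
T           [ σ ] = T
F           [ σ ] = F
atom a      [ σ ] = atom a
(x ◁ y ▷ z) [ σ ] = (x [ σ ]) ◁ (y [ σ ]) ▷ (z [ σ ])

weaken : ∀ {A X} → ClosedTerm A → Term A X
weaken t = t [ ⊥-elim ]

-- A set of equations, with variables drawn from the countable supply ℕ.
Equations : Set → Set₁
Equations A = Rel (Term A ℕ) 0ℓ

infix 4 _⊢_≈_

data _⊢_≈_ {A : Set} (E : Equations A) : Term A ℕ → Term A ℕ → Set where
  axiom      : ∀ {t u} → E t u → E ⊢ t ≈ u
  reflexive  : ∀ {t} → E ⊢ t ≈ t
  symmetric  : ∀ {t u} → E ⊢ t ≈ u → E ⊢ u ≈ t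
  transitive : ∀ {t u v} → E ⊢ t ≈ u → E ⊢ u ≈ v → E ⊢ t ≈ v
  congruent  : ∀ {x x′ y y′ z z′} →
               E ⊢ x ≈ x′ → E ⊢ y ≈ y′ → E ⊢ z ≈ z′ →
               E ⊢ x ◁ y ▷ z ≈ x′ ◁ y′ ▷ z′
  substitute : ∀ {t u} (σ : ℕ → Term A ℕ) → E ⊢ t ≈ u → E ⊢ t [ σ ] ≈ u [ σ ]

module _ {A : Set} where
  private
    x y z u v : Term A ℕ
    x = var 0
    y = var 1
    z = var 2
    u = var 3
    v = var 4

  data CP : Equations A where
    CP1 : CP (x ◁ T ▷ y) x
    CP2 : CP (x ◁ F ▷ y) y
    CP3 : CP (T ◁ x ▷ F) x
    CP4 : CP (x ◁ (y ◁ z ▷ u) ▷ v) ((x ◁ y ▷ v) ◁ z ▷ (x ◁ u ▷ v))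

record CEAlgebra (A : Set) : Set₁ where
  field
    Carrier : Set
    true    : Carrier
    false   : Carrier
    atomᶜ   : A → Carrier
    cond    : Carrier → Carrier → Carrier → Carrier

  ⟦_⟧ : ∀ {X} → Term A X → (X → Carrier) → Carrier
  ⟦ var x ⟧     ρ = ρ x
  ⟦ T ⟧         ρ = true
  ⟦ F ⟧         ρ = false
  ⟦ atom a ⟧    ρ = atomᶜ a
  ⟦ x ◁ y ▷ z ⟧ ρ = cond (⟦ x ⟧ ρ) (⟦ y ⟧ ρ) (⟦ z ⟧ ρ)

infix 4 _⊨_≈_

_⊨_≈_ : ∀ {A X} → CEAlgebra A → Term A X → Term A X → Set
𝔸 ⊨ t ≈ u = ∀ ρ → ⟦ t ⟧ ρ ≡ ⟦ u ⟧ ρ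
  where open CEAlgebra 𝔸

record StatefulPropositionAlgebra (A : Set) : Set₁ where
  field
    reduct : CEAlgebra A

  open CEAlgebra reduct public
    renaming (Carrier to C; true to Tᶜ; false to Fᶜ; cond to infix 8 _◁ᶜ_▷_)

  infix  8 _◁ˢ_▷_
  infixr 9 _•_
  infix  9 _!_

  field
    S      : Set
    c      : S
    _◁ˢ_▷_ : S → C → S → S
    _•_    : C → S → S
    _!_    : C → S → C

    cp   : ∀ {t u} → CP t u → reduct ⊨ t ≈ u

    TS1  : ∀ s s′ → s ◁ˢ Tᶜ ▷ s′ ≡ s
    TS2  : ∀ s s′ → s ◁ˢ Fᶜ ▷ s′ ≡ s′
    TS3  : ∀ x s s′ → x ≢ Tᶜ → x ≢ Fᶜ → s ◁ˢ x ▷ s′ ≡ c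

    SPA1 : ∀ s → Tᶜ ! s ≡ Tᶜ
    SPA2 : ∀ s → Fᶜ ! s ≡ Fᶜ
    SPA3 : ∀ x y z s →
           (x ◁ᶜ y ▷ z) ! s ≡ (x ! (y • s)) ◁ᶜ (y ! s) ▷ (z ! (y • s))
    SPA4 : ∀ s → Tᶜ • s ≡ s
    SPA5 : ∀ s → Fᶜ • s ≡ s
    SPA6 : ∀ x y z s →
           (x ◁ᶜ y ▷ z) • s ≡ (x • (y • s)) ◁ˢ (y ! s) ▷ (z • (y • s))
    SPA7 : ∀ x s → x ! s ≡ Tᶜ ⊎ x ! s ≡ Fᶜ
    SPA8 : ∀ x y → (∀ s → x ! s ≡ y ! s × x • s ≡ y • s) → x ≡ y

IsHoareMcCarthyAlgebra : ∀ {A} → CEAlgebra A → Set₁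
IsHoareMcCarthyAlgebra {A} 𝔸 =
  Σ[ 𝕊 ∈ StatefulPropositionAlgebra A ] StatefulPropositionAlgebra.reduct 𝕊 ≡ 𝔸

{-# OPTIONS --safe #-}

-- Modulo CP, closed terms are binary decision trees whose inner nodes carry
-- atoms, and the algebra of such trees is the initial CP-algebra; the point is
-- to equip it with states.  A state consists of the replies still to be given
-- and the history of the atoms evaluated so far: evaluating an atom consumes a
-- reply and is recorded.  Since the replies can be chosen freely, every path of
-- a tree is followed from some state, and the history shows the atoms on it, so
-- distinct trees are separated.

module Submission where

open import Defs
open import Data.Bool.Base using (Bool; true; false)
open import Data.Empty using (⊥)
open import Data.List.Base using (List; []; _∷_; length)
open import Data.Nat.Base using (ℕ; suc; _≤_; _<_)
open import Data.Nat.Properties using (≤-refl; <⇒≤; <-irrefl)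
open import Data.Product.Base using (Σ-syntax; _×_; _,_; proj₁; proj₂)
open import Data.Sum.Base using (_⊎_; inj₁; inj₂)
open import Function.Base using (_∘_)
open import Function.Bundles using (_⇔_; mk⇔)
open import Relation.Binary.PropositionalEquality
  using (_≡_; _≢_; refl; sym; trans; cong; cong₂; module ≡-Reasoning)
open import Relation.Nullary.Negation using (contradiction)

private
  variable
    A X Y : Set

module _ (𝔸 : CEAlgebra A) where
  open CEAlgebra 𝔸

  cond-cong : ∀ {x x′ y y′ z z′} → x ≡ x′ → y ≡ y′ → z ≡ z′ →
              cond x y z ≡ cond x′ y′ z′
  cond-cong refl refl refl = refl

  -- Stating the agreement with `τ` pointwise avoids function extensionality, notably for
  -- assignments out of `⊥`.
  ⟦⟧-subst : (t : Term A X) (σ : X → Term A Y) {ρ : Y → Carrier} {τ : X → Carrier} →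
             (∀ x → ⟦ σ x ⟧ ρ ≡ τ x) → ⟦ t [ σ ] ⟧ ρ ≡ ⟦ t ⟧ τ
  ⟦⟧-subst (var x)     σ eq = eq x
  ⟦⟧-subst T           σ eq = refl
  ⟦⟧-subst F           σ eq = refl
  ⟦⟧-subst (atom a)    σ eq = refl
  ⟦⟧-subst (x ◁ y ▷ z) σ eq =
    cond-cong (⟦⟧-subst x σ eq) (⟦⟧-subst y σ eq) (⟦⟧-subst z σ eq)

  ⟦⟧-weaken : (t : ClosedTerm A) (ρ : X → Carrier) {τ : ⊥ → Carrier} → ⟦ weaken t ⟧ ρ ≡ ⟦ t ⟧ τ
  ⟦⟧-weaken t ρ = ⟦⟧-subst t _ λ ()

  ⊢-sound : {E : Equations A} → (∀ {t u} → E t u → 𝔸 ⊨ t ≈ u) →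
            ∀ {t u} → E ⊢ t ≈ u → 𝔸 ⊨ t ≈ u
  ⊢-sound ax (axiom e)        ρ = ax e ρ
  ⊢-sound ax reflexive        ρ = refl
  ⊢-sound ax (symmetric p)    ρ = sym (⊢-sound ax p ρ)
  ⊢-sound ax (transitive p q) ρ = trans (⊢-sound ax p ρ) (⊢-sound ax q ρ)
  ⊢-sound ax (congruent p q r) ρ =
    cond-cong (⊢-sound ax p ρ) (⊢-sound ax q ρ) (⊢-sound ax r ρ)
  ⊢-sound ax (substitute {t} {u} σ p) ρ = begin
    ⟦ t [ σ ] ⟧ ρ             ≡⟨ ⟦⟧-subst t σ (λ _ → refl) ⟩
    ⟦ t ⟧ (λ x → ⟦ σ x ⟧ ρ)   ≡⟨ ⊢-sound ax p _ ⟩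
    ⟦ u ⟧ (λ x → ⟦ σ x ⟧ ρ)   ≡⟨ ⟦⟧-subst u σ (λ _ → refl) ⟨
    ⟦ u [ σ ] ⟧ ρ             ∎
    where open ≡-Reasoning

data Tree (A : Set) : Set where
  leaf   : Bool → Tree A
  branch : Tree A → A → Tree A → Tree A

-- This is the bind of the tree monad, with continuation `true` to `x` and `false` to `z`. CP1 and
-- CP2 are its left unit law, CP3 the right unit law and CP4 associativity.
graft : Tree A → Tree A → Tree A → Tree A
graft x (leaf true)    z = x
graft x (leaf false)   z = z
graft x (branch l a r) z = branch (graft x l z) a (graft x r z)

graft-identity : (y : Tree A) → graft (leaf true) y (leaf false) ≡ y
graft-identity (leaf true)    = refl
graft-identity (leaf false)   = refl
graft-identity (branch l a r) =
  cong₂ (λ l′ r′ → branch l′ a r′) (graft-identity l) (graft-identity r)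

graft-assoc : (x y z u v : Tree A) →
              graft x (graft y z u) v ≡ graft (graft x y v) z (graft x u v)
graft-assoc x y (leaf true)    u v = refl
graft-assoc x y (leaf false)   u v = refl
graft-assoc x y (branch l a r) u v =
  cong₂ (λ l′ r′ → branch l′ a r′) (graft-assoc x y l u v) (graft-assoc x y r u v)

treeAlgebra : (A : Set) → CEAlgebra A
treeAlgebra A = record
  { Carrier = Tree A
  ; true    = leaf true
  ; false   = leaf false
  ; atomᶜ   = λ a → branch (leaf true) a (leaf false)
  ; cond    = graft
  }

treeAlgebra-CP : ∀ {t u} → CP t u → treeAlgebra A ⊨ t ≈ u
treeAlgebra-CP CP1 ρ = refl
treeAlgebra-CP CP2 ρ = refl
treeAlgebra-CP CP3 ρ = graft-identity (ρ 0)
treeAlgebra-CP CP4 ρ = graft-assoc (ρ 0) (ρ 1) (ρ 2) (ρ 3) (ρ 4)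

-- Replies are taken from the list and are false once it is exhausted; the
-- history has the most recent atom first.
State : Set → Set
State A = List Bool × List A

reply : Tree A → State A → Bool
reply (leaf b)       s                = b
reply (branch l a r) ([]         , h) = reply r ([] , a ∷ h)
reply (branch l a r) (true  ∷ bs , h) = reply l (bs , a ∷ h)
reply (branch l a r) (false ∷ bs , h) = reply r (bs , a ∷ h)

apply : Tree A → State A → State A
apply (leaf b)       s                = s
apply (branch l a r) ([]         , h) = apply r ([] , a ∷ h)
apply (branch l a r) (true  ∷ bs , h) = apply l (bs , a ∷ h)
apply (branch l a r) (false ∷ bs , h) = apply r (bs , a ∷ h)

select : State A → Tree A → State A → State A
select s (leaf true)    s′ = s
select s (leaf false)   s′ = s′
select s (branch _ _ _) s′ = [] , []

select-otherwise : (x : Tree A) (s s′ : State A) →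
                   x ≢ leaf true → x ≢ leaf false → select s x s′ ≡ ([] , [])
select-otherwise (leaf true)    s s′ x≢T x≢F = contradiction refl x≢T
select-otherwise (leaf false)   s s′ x≢T x≢F = contradiction refl x≢F
select-otherwise (branch _ _ _) s s′ x≢T x≢F = refl

-- Induction on the condition `y`: at a branch both sides use up the same reply and record the same
-- atom, which leaves the claim for the subtree entered.
reply-graft : (x y z : Tree A) (s : State A) →
              leaf {A} (reply (graft x y z) s) ≡
              graft (leaf (reply x (apply y s))) (leaf (reply y s)) (leaf (reply z (apply y s)))
reply-graft x (leaf true)    z s                = refl
reply-graft x (leaf false)   z s                = refl
reply-graft x (branch l a r) z ([]         , h) = reply-graft x r z ([] , a ∷ h)
reply-graft x (branch l a r) z (true  ∷ bs , h) = reply-graft x l z (bs , a ∷ h)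
reply-graft x (branch l a r) z (false ∷ bs , h) = reply-graft x r z (bs , a ∷ h)

apply-graft : (x y z : Tree A) (s : State A) →
              apply (graft x y z) s ≡
              select (apply x (apply y s)) (leaf (reply y s)) (apply z (apply y s))
apply-graft x (leaf true)    z s                = refl
apply-graft x (leaf false)   z s                = refl
apply-graft x (branch l a r) z ([]         , h) = apply-graft x r z ([] , a ∷ h)
apply-graft x (branch l a r) z (true  ∷ bs , h) = apply-graft x l z (bs , a ∷ h)
apply-graft x (branch l a r) z (false ∷ bs , h) = apply-graft x r z (bs , a ∷ h)

leaf-true-or-false : (b : Bool) → leaf {A} b ≡ leaf true ⊎ leaf {A} b ≡ leaf false
leaf-true-or-false true  = inj₁ refl
leaf-true-or-false false = inj₂ refl

apply-history-≤ : (x : Tree A) (s : State A) →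
                  length (proj₂ s) ≤ length (proj₂ (apply x s))
apply-history-≤ (leaf b)       s                = ≤-refl
apply-history-≤ (branch l a r) ([]         , h) = <⇒≤ (apply-history-≤ r ([] , a ∷ h))
apply-history-≤ (branch l a r) (true  ∷ bs , h) = <⇒≤ (apply-history-≤ l (bs , a ∷ h))
apply-history-≤ (branch l a r) (false ∷ bs , h) = <⇒≤ (apply-history-≤ r (bs , a ∷ h))

-- The subtree starts with `a` already recorded, so its weak bound is strict for `h`. A leaf keeps
-- the history as it is, so from histories of equal length it cannot end in the same state as a
-- branch.
branch-lengthens-history : (l r : Tree A) (a : A) (h : List A) →
                           length h < length (proj₂ (apply (branch l a r) ([] , h)))
branch-lengthens-history l r a h = apply-history-≤ r ([] , a ∷ h)

-- Letting the two initial histories differ makes the induction also yield that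
-- the root atoms agree: they are the heads of the histories of the subtrees.
separation : (x y : Tree A) (h k : List A) → length h ≡ length k →
             (∀ bs → reply x (bs , h) ≡ reply y (bs , k) ×
                     apply x (bs , h) ≡ apply y (bs , k)) →
             x ≡ y × h ≡ k
separation (leaf b) (leaf b′) h k len eq =
  cong leaf (proj₁ (eq [])) , cong proj₂ (proj₂ (eq []))
separation (leaf b) (branch l a r) h k len eq =
  contradiction (branch-lengthens-history l r a k)
    (<-irrefl (trans (sym len) (cong (length ∘ proj₂) (proj₂ (eq [])))))
separation (branch l a r) (leaf b) h k len eq =
  contradiction (branch-lengthens-history l r a h)
    (<-irrefl (trans len (cong (length ∘ proj₂) (sym (proj₂ (eq []))))))
separation (branch l a r) (branch l′ a′ r′) h k len eq
  with refl , refl ← separation l l′ (a ∷ h) (a′ ∷ k) (cong suc len) (eq ∘ (true ∷_))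
     | refl , _    ← separation r r′ (a ∷ h) (a′ ∷ k) (cong suc len) (eq ∘ (false ∷_))
  = refl , refl

treeSPA : (A : Set) → StatefulPropositionAlgebra A
treeSPA A = record
  { reduct = treeAlgebra A
  ; S      = State A
  ; c      = [] , []
  ; _◁ˢ_▷_ = select
  ; _•_    = apply
  ; _!_    = λ x s → leaf (reply x s)
  ; cp     = treeAlgebra-CP
  ; TS1    = λ _ _ → refl
  ; TS2    = λ _ _ → refl
  ; TS3    = select-otherwise
  ; SPA1   = λ _ → refl
  ; SPA2   = λ _ → refl
  ; SPA3   = reply-graft
  ; SPA4   = λ _ → refl
  ; SPA5   = λ _ → refl
  ; SPA6   = apply-graft
  ; SPA7   = λ x s → leaf-true-or-false (reply x s)
  -- States with empty history and arbitrary replies already separate trees.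
  ; SPA8   = λ x y eq → proj₁ (separation x y [] [] refl
               λ bs → leaf-injective (proj₁ (eq (bs , []))) , proj₂ (eq (bs , [])))
  }
  where
  leaf-injective : ∀ {b b′} → leaf {A} b ≡ leaf b′ → b ≡ b′
  leaf-injective refl = refl

-- The image consists of the basic forms of proposition algebra, in which every condition is a
-- single atom.
toTerm : Tree A → Term A X
toTerm (leaf true)    = T
toTerm (leaf false)   = F
toTerm (branch l a r) = toTerm l ◁ atom a ▷ toTerm r

-- Indices 0 to 4 are the variables `x y z u v` of `CP`; the catch-all clause serves index 4.
assign : (x y z u v : Term A ℕ) → ℕ → Term A ℕ
assign x y z u v 0 = x
assign x y z u v 1 = y
assign x y z u v 2 = z
assign x y z u v 3 = u
assign x y z u v _ = v

-- CP4 pushes the conditional below the root atom into both subtrees, until CP1 or CP2 resolves it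
-- at the leaves.
toTerm-graft : (x y z : Tree A) →
               CP ⊢ toTerm x ◁ toTerm y ▷ toTerm z ≈ toTerm (graft x y z)
toTerm-graft x (leaf true)    z =
  substitute (assign (toTerm x) (toTerm z) T T T) (axiom CP1)
toTerm-graft x (leaf false)   z =
  substitute (assign (toTerm x) (toTerm z) T T T) (axiom CP2)
toTerm-graft x (branch l a r) z = transitive
  (substitute (assign (toTerm x) (toTerm l) (atom a) (toTerm r) (toTerm z)) (axiom CP4))
  (congruent (toTerm-graft x l z) reflexive (toTerm-graft x r z))

module _ {A : Set} where
  open CEAlgebra (treeAlgebra A) using (⟦_⟧)

  noVars : ⊥ → Tree A
  noVars ()

  -- The key to completeness: the basic form depends only on the value of `t`, so terms of equal
  -- value are both provably equal to one basic form.
  normalise : (t : ClosedTerm A) → CP ⊢ weaken t ≈ toTerm (⟦ t ⟧ noVars)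
  normalise T           = reflexive
  normalise F           = reflexive
  normalise (atom a)    =
    -- The basic form of an atom is `T ◁ atom a ▷ F`, so CP3 is read from right to left.
    symmetric (substitute (assign (atom a) T T T T) (axiom CP3))
  normalise (x ◁ y ▷ z) = transitive
    (congruent (normalise x) (normalise y) (normalise z))
    (toTerm-graft (⟦ x ⟧ noVars) (⟦ y ⟧ noVars) (⟦ z ⟧ noVars))

  closed-sound : (t t′ : ClosedTerm A) →
                 CP ⊢ weaken t ≈ weaken t′ → treeAlgebra A ⊨ t ≈ t′
  closed-sound t t′ p ρ = begin
    ⟦ t ⟧ ρ           ≡⟨ ⟦⟧-weaken (treeAlgebra A) t τ ⟨
    ⟦ weaken t ⟧ τ    ≡⟨ ⊢-sound (treeAlgebra A) treeAlgebra-CP p τ ⟩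
    ⟦ weaken t′ ⟧ τ   ≡⟨ ⟦⟧-weaken (treeAlgebra A) t′ τ ⟩
    ⟦ t′ ⟧ ρ          ∎
    where
    open ≡-Reasoning
    τ : ℕ → Tree A
    -- A derivation may pass through open terms, so their variables need values; as its endpoints
    -- are closed, any choice will do.
    τ _ = leaf true

  closed-complete : (t t′ : ClosedTerm A) →
                    treeAlgebra A ⊨ t ≈ t′ → CP ⊢ weaken t ≈ weaken t′
  closed-complete t t′ eq = transitive (normalise t) (symmetric normalise′)
    where
    normalise′ : CP ⊢ weaken t′ ≈ toTerm (⟦ t ⟧ noVars)
    normalise′ rewrite eq noVars = normalise t′

theorem1 : (A : Set) → A → Denumerable A →
    Σ[ 𝔸 ∈ CEAlgebra A ]
    (IsHoareMcCarthyAlgebra 𝔸 ×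
    ((t t′ : ClosedTerm A) →
    (CP ⊢ weaken t ≈ weaken t′) ⇔ (𝔸 ⊨ t ≈ t′)))
theorem1 A _ _ =
  treeAlgebra A ,
  (treeSPA A , refl) ,
  λ t t′ → mk⇔ (closed-sound t t′) (closed-complete t t′)
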